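{- Let $n\geq 1$ and let $\mathcal{N}:L_n([0,1])\to L_n([0,1])$ be an $n$-dimensional fuzzy negation. Then $\mathcal{N}$ is $n$-representable if and only if $\mathcal{N}$ is $\subseteq$-monotone.
   Context: $L_n([0,1])=\{(x_1,\ldots,x_n)\in[0,1]^n : x_1\leq\cdots\leq x_n\}$, with projections $\pi_i(x_1,\ldots,x_n)=x_i$ and the componentwise order: $\mathbf{x}\leq\mathbf{y}$ iff $\pi_i(\mathbf{x})\leq\pi_i(\mathbf{y})$ for all $i$. For $x\in[0,1]$, $/x/=(x,\ldots,x)\in L_n([0,1])$. A fuzzy negation is a function $N:[0,1]\to[0,1]$ with $N(0)=1$, $N(1)=0$ and $N(x)\geq N(y)$ whenever $x\leq y$. An $n$-dimensional fuzzy negation is a function $\mathcal{N}:L_n([0,1])\to L_n([0,1])$ with $\mathcal{N}(/0/)=/1/$, $\mathcal{N}(/1/)=/0/$ and $\mathcal{N}(\mathbf{x})\geq\mathcal{N}(\mathbf{y})$ whenever $\mathbf{x}\leq\mathbf{y}$. For fuzzy negations $N_1\leq\cdots\leq N_n$ (pointwise), $\widetilde{N_1\ldots N_n}(\mathbf{x})=(N_1(\pi_n(\mathbf{x})),N_2(\pi_{n-1}(\mathbf{x})),\ldots,N_n(\pi_1(\mathbf{x})))$, i.e. the $i$-th component is $N_i(\pi_{n-i+1}(\mathbf{x}))$. $\mathcal{N}$ is $n$-representable if there exist fuzzy negations $N_1\leq\cdots\leq N_n$ with $\mathcal{N}=\widetilde{N_1\ldots N_n}$. For $i=1,\ldots,n-1$,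 $\mathbf{x}\subseteq_i\mathbf{y}$ means $\pi_i(\mathbf{y})\leq\pi_i(\mathbf{x})\leq\pi_{i+1}(\mathbf{x})\leq\pi_{i+1}(\mathbf{y})$. $\mathcal{N}$ is $\subseteq_i$-monotone if for all $\mathbf{x},\mathbf{y}\in L_n([0,1])$, $\mathbf{x}\subseteq_{n-i}\mathbf{y}$ implies $\mathcal{N}(\mathbf{x})\subseteq_i\mathcal{N}(\mathbf{y})$. $\mathcal{N}$ is $\subseteq$-monotone if it is $\subseteq_i$-monotone for every $i=1,\ldots,n-1$. -}

module Defs where

open import Data.Fin as Fin using (Fin; zero; suc; inject₁; opposite)
open import Data.Fin.Properties using (opposite-prop)
open import Data.Nat as ℕ using (ℕ; suc)
import Data.Nat.Properties as ℕₚ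
open import Data.Product using (∃; _×_; _,_)
open import Data.Rational as ℚ using (ℚ; 0ℚ; 1ℚ)
import Data.Rational.Properties as ℚₚ
open import Data.Sum using (_⊎_; inj₁; inj₂)
open import Data.Vec.Functional using (Vector; replicate)
open import Data.Vec.Functional.Relation.Binary.Pointwise using (Pointwise)
open import Function using (id; _∘_; _⇔_; mk⇔)
open import Level using (0ℓ)
open import Relation.Binary using (Rel; Reflexive; Transitive; tri<; tri≈; tri>)
open import Relation.Binary.Construct.Interior.Symmetric using (SymInterior)
open import Relation.Binary.Definitions using (Monotonic₁; Antitonic₁)
open import Relation.Binary.PropositionalEquality using (refl; sym; subst₂)
open import Relation.Nullary using (¬_)
open import Relation.Nullary.Decidable using (from-yes)
open import Relation.Unary using (Pred; _⊆_; Satisfiable)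

-- Real numbers as two-sided, located Dedekind cuts:
-- lower q means q < x, and upper q means x < q.

record ℝ : Set₁ where
  field
    lower           : Pred ℚ 0ℓ
    upper           : Pred ℚ 0ℓ
    lower-inhabited : Satisfiable lower
    upper-inhabited : Satisfiable upper
    lower-rounded   : ∀ p → lower p ⇔ (∃ λ q → p ℚ.< q × lower q)
    upper-rounded   : ∀ q → upper q ⇔ (∃ λ p → p ℚ.< q × upper p)
    disjoint        : ∀ q → ¬ (lower q × upper q)
    located         : ∀ p q → p ℚ.< q → lower p ⊎ upper q

-- Comparing lower cuts suffices: by locatedness and roundedness,
-- lower x ⊆ lower y is equivalent to upper y ⊆ upper x.

_≤ᴿ_ : Rel ℝ 0ℓ
x ≤ᴿ y = ℝ.lower x ⊆ ℝ.lower y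

fromℚ : ℚ → ℝ
fromℚ r = record
  { lower           = ℚ._< r
  ; upper           = r ℚ.<_
  ; lower-inhabited = r ℚ.- 1ℚ , r-1<r
  ; upper-inhabited = r ℚ.+ 1ℚ , r<r+1
  ; lower-rounded   = λ p → mk⇔
      (λ p<r → ℚₚ.<-dense p<r)
      (λ (q , p<q , q<r) → ℚₚ.<-trans p<q q<r)
  ; upper-rounded   = λ q → mk⇔
      (λ r<q → let (p , r<p , p<q) = ℚₚ.<-dense r<q in p , p<q , r<p)
      (λ (p , p<q , r<p) → ℚₚ.<-trans r<p p<q)
  ; disjoint        = λ q (q<r , r<q) → ℚₚ.<-asym q<r r<q
  ; located         = loc
  }
  where
  r-1<r : r ℚ.- 1ℚ ℚ.< r
  r-1<r = subst₂ ℚ._<_ refl (ℚₚ.+-identityʳ r)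
    (ℚₚ.+-monoʳ-< r (from-yes (ℚ.- 1ℚ ℚₚ.<? 0ℚ)))

  r<r+1 : r ℚ.< r ℚ.+ 1ℚ
  r<r+1 = subst₂ ℚ._<_ (ℚₚ.+-identityʳ r) refl
    (ℚₚ.+-monoʳ-< r (from-yes (0ℚ ℚₚ.<? 1ℚ)))

  loc : ∀ p q → p ℚ.< q → p ℚ.< r ⊎ r ℚ.< q
  loc p q p<q with ℚₚ.<-cmp p r
  ... | tri< p<r _ _  = inj₁ p<r
  ... | tri≈ _ refl _ = inj₂ p<q
  ... | tri> _ _ r<p  = inj₂ (ℚₚ.<-trans r<p p<q)

0ᴿ 1ᴿ : ℝ
0ᴿ = fromℚ 0ℚ
1ᴿ = fromℚ 1ℚ

record 𝕀 : Set₁ where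
  field
    value : ℝ
    0≤    : 0ᴿ ≤ᴿ value
    ≤1    : value ≤ᴿ 1ᴿ

infix 4 _≤_ _≈_ _≤ₗ_ _≈ₗ_ _≤ᶠ_

_≤_ : Rel 𝕀 0ℓ
x ≤ y = 𝕀.value x ≤ᴿ 𝕀.value y

-- Equality of real numbers. Antitone maps automatically respect it, so the
-- functions below need no separate congruence hypothesis.

_≈_ : Rel 𝕀 0ℓ
_≈_ = SymInterior _≤_

≤-refl : Reflexive _≤_
≤-refl = id

≤-trans : Transitive _≤_
≤-trans x≤y y≤z = y≤z ∘ x≤y

0≤1 : 0ᴿ ≤ᴿ 1ᴿ
0≤1 p<0 = ℚₚ.<-trans p<0 (from-yes (0ℚ ℚₚ.<? 1ℚ))

0ᴵ 1ᴵ : 𝕀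
0ᴵ = record { value = 0ᴿ ; 0≤ = id ; ≤1 = 0≤1 }
1ᴵ = record { value = 1ᴿ ; 0≤ = 0≤1 ; ≤1 = id }

record L (n : ℕ) : Set₁ where
  field
    π      : Vector 𝕀 n
    sorted : Monotonic₁ Fin._≤_ _≤_ π

open L public

_≤ₗ_ : ∀ {n} → Rel (L n) 0ℓ
x ≤ₗ y = Pointwise _≤_ (π x) (π y)

_≈ₗ_ : ∀ {n} → Rel (L n) 0ℓ
x ≈ₗ y = Pointwise _≈_ (π x) (π y)

/_/ : ∀ {n} → 𝕀 → L n
/_/ {n} x = record { π = replicate n x ; sorted = λ _ → ≤-refl {x} }

record IsFuzzyNegation (N : 𝕀 → 𝕀) : Set₁ where
  field
    N0≈1     : N 0ᴵ ≈ 1ᴵ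
    N1≈0     : N 1ᴵ ≈ 0ᴵ
    antitone : Antitonic₁ _≤_ _≤_ N

record IsDimFuzzyNegation {n : ℕ} (𝒩 : L n → L n) : Set₁ where
  field
    𝒩0≈1     : 𝒩 / 0ᴵ / ≈ₗ / 1ᴵ /
    𝒩1≈0     : 𝒩 / 1ᴵ / ≈ₗ / 0ᴵ /
    antitone : Antitonic₁ _≤ₗ_ _≤ₗ_ 𝒩

_≤ᶠ_ : Rel (𝕀 → 𝕀) _
N ≤ᶠ M = ∀ x → N x ≤ M x

record NegationChain (n : ℕ) : Set₁ where
  field
    N          : Vector (𝕀 → 𝕀) n
    isNegation : ∀ i → IsFuzzyNegation (N i)
    increasing : Monotonic₁ Fin._≤_ _≤ᶠ_ N

opposite-antitone : ∀ {n} → Antitonic₁ Fin._≤_ Fin._≤_ (opposite {n})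
opposite-antitone {n} {i} {j} j≤i =
  subst₂ ℕ._≤_ (sym (opposite-prop i)) (sym (opposite-prop j))
    (ℕₚ.∸-monoʳ-≤ n (ℕ.s≤s j≤i))

-- With indices counted from 0, opposite i corresponds to n - i + 1.

tilde : ∀ {n} → NegationChain n → L n → L n
tilde c x = record
  { π      = λ i → N i (π x (opposite i))
  ; sorted = λ {i} {j} i≤j →
      ≤-trans {N i (π x (opposite i))} {N j (π x (opposite i))}
              {N j (π x (opposite j))}
        (increasing i≤j (π x (opposite i)))
        (IsFuzzyNegation.antitone (isNegation j)
          {π x (opposite i)} {π x (opposite j)}
          (sorted x (opposite-antitone {x = j} {y = i} i≤j)))
  }
  where open NegationChain c

Representable : ∀ {n} → (L n → L n) → Set₁
Representable {n} 𝒩 = ∃ λ (c : NegationChain n) → ∀ x → 𝒩 x ≈ₗ tilde c x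

-- In dimension suc m, the index i ∈ {1, …, m} of ⊆ᵢ is i - 1 : Fin m; then
-- inject₁ and suc give the positions of πᵢ and πᵢ₊₁, and opposite (on Fin m)
-- takes the index i to suc m - i.

_⊆[_]_ : ∀ {m} → L (suc m) → Fin m → L (suc m) → Set
x ⊆[ i ] y =
  π y (inject₁ i) ≤ π x (inject₁ i) ×
  π x (inject₁ i) ≤ π x (suc i) ×
  π x (suc i) ≤ π y (suc i)

⊆[_]-Monotone : ∀ {m} → Fin m → (L (suc m) → L (suc m)) → Set₁
⊆[ i ]-Monotone 𝒩 = ∀ x y → x ⊆[ opposite i ] y → 𝒩 x ⊆[ i ] 𝒩 y

⊆-Monotone : ∀ {m} → (L (suc m) → L (suc m)) → Set₁
⊆-Monotone 𝒩 = ∀ i → ⊆[ i ]-Monotone 𝒩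

-- The i-th component of 𝒩 x can depend only on the entry a of x at the opposite
-- position. The constant vector / a / satisfies / a / ⊆ x on either pair of
-- adjacent positions containing a, so the two instances of ⊆-monotonicity
-- bound the component of 𝒩 x by that of 𝒩 / a / from both sides. At the
-- two ends, where one of the pairs is missing, a is an extreme entry of x
-- and antitonicity supplies the other bound. Hence t ↦ πᵢ (𝒩 / t /)
-- represents 𝒩.

module Submission where

open import Data.Fin as Fin using (Fin; zero; suc; inject₁; fromℕ; opposite)
import Data.Fin.Properties as Finₚ
open import Data.Fin.Relation.Unary.Top using (view; ‵fromℕ; ‵inject₁)
open import Data.Nat using (ℕ; zero; suc; z≤n)
import Data.Nat.Properties as ℕₚ
open import Data.Product using (_,_; proj₁; proj₂)
open import Function using (id)
open import Function.Bundles using (_⇔_; mk⇔)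
open import Relation.Binary.Construct.Interior.Symmetric using (lhs≤rhs; rhs≤lhs; _,_)
open import Relation.Binary.PropositionalEquality using (_≡_; refl; cong)
open import Defs

opposite-fromℕ : ∀ m → opposite (fromℕ m) ≡ zero
opposite-fromℕ zero    = refl
opposite-fromℕ (suc m) = cong inject₁ (opposite-fromℕ m)

opposite-inject₁ : ∀ {m} (i : Fin m) → opposite (inject₁ i) ≡ suc (opposite i)
opposite-inject₁ {suc m} zero    = refl
opposite-inject₁ {suc m} (suc i) = cong inject₁ (opposite-inject₁ i)

inject₁≤suc : ∀ {m} (i : Fin m) → inject₁ i Fin.≤ suc i
inject₁≤suc i = ℕₚ.≤-trans (ℕₚ.≤-reflexive (Finₚ.toℕ-inject₁ i)) (ℕₚ.n≤1+n _)

module _ {m : ℕ} (𝒩 : L (suc m) → L (suc m)) where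

  -- Antitonicity of each negation swaps the two outer inequalities: the right one for x and y gives
  -- the left one for their images, and conversely.
  representable⇒⊆-monotone : Representable 𝒩 → ⊆-Monotone 𝒩
  representable⇒⊆-monotone (c , 𝒩≈c) i x y (yᵢ≤xᵢ , _ , xᵢ₊₁≤yᵢ₊₁) =
      (λ p → rhs≤lhs (𝒩≈c x (inject₁ i)) (left (lhs≤rhs (𝒩≈c y (inject₁ i)) p)))
    , sorted (𝒩 x) (inject₁≤suc i)
    , (λ p → rhs≤lhs (𝒩≈c y (suc i)) (right (lhs≤rhs (𝒩≈c x (suc i)) p)))
    where
    left : π (tilde c y) (inject₁ i) ≤ π (tilde c x) (inject₁ i)
    -- `opposite` computes on `suc i` but not on `inject₁ i`, so `right` needs no rewrite.
    left rewrite opposite-inject₁ i =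
      IsFuzzyNegation.antitone (NegationChain.isNegation c (inject₁ i)) xᵢ₊₁≤yᵢ₊₁

    right : π (tilde c x) (suc i) ≤ π (tilde c y) (suc i)
    right = IsFuzzyNegation.antitone (NegationChain.isNegation c (suc i)) yᵢ≤xᵢ

  module _ (neg : IsDimFuzzyNegation 𝒩) where
    open IsDimFuzzyNegation neg

    diagonal : NegationChain (suc m)
    diagonal = record
      { N          = λ i t → π (𝒩 / t /) i
      ; isNegation = λ i → record
        { N0≈1     = 𝒩0≈1 i
        ; N1≈0     = 𝒩1≈0 i
        ; antitone = λ {s} {t} t≤s → antitone {/ s /} {/ t /} (λ _ → t≤s) i
        }
      ; increasing = λ i≤j t → sorted (𝒩 / t /) i≤j
      }

    ⊆-monotone⇒representable : ⊆-Monotone 𝒩 → Representable 𝒩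
    ⊆-monotone⇒representable mono = diagonal , λ x i → upper x i , lower x i
      where
      upper : ∀ x i → π (𝒩 x) i ≤ π (tilde diagonal x) i
      -- Monotonicity bounds from above only the left component of a pair, so the last position is
      -- split off.
      upper x i with view i
      ... | ‵fromℕ rewrite opposite-fromℕ m =
        antitone {x} {/ π x zero /} (λ _ → sorted x z≤n) (fromℕ m)
      ... | ‵inject₁ k rewrite opposite-inject₁ k =
        proj₁ (mono k / π x (suc (opposite k)) / x
          (sorted x (inject₁≤suc (opposite k)) , id , id))

      lower : ∀ x i → π (tilde diagonal x) i ≤ π (𝒩 x) i
      lower x zero    = antitone {/ π x (fromℕ m) /} {x} (λ j → sorted x (Finₚ.≤fromℕ j)) zero
      -- Now `suc k` is the right component of its pair, and the constant is the left entry of the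
      -- opposite pair.
      lower x (suc k) = proj₂ (proj₂ (mono k / π x (inject₁ (opposite k)) / x
        (id , id , sorted x (inject₁≤suc (opposite k)))))

theorem10 : (m : ℕ) (𝒩 : L (suc m) → L (suc m)) → IsDimFuzzyNegation 𝒩 →
    Representable 𝒩 ⇔ ⊆-Monotone 𝒩
theorem10 m 𝒩 neg = mk⇔ (representable⇒⊆-monotone 𝒩) (⊆-monotone⇒representable 𝒩 neg)
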